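{- Let $p$ be a prime with $p\equiv 3 \pmod 4$. Then $$\sum_{k=0}^{p-1}\frac{\binom{2k}{k} f_k}{(-16)^k} \equiv 0 \pmod{p}.$$
   Context: The Franel numbers are defined by $f_n=\sum_{k=0}^n \binom{n}{k}^3$ for integers $n\ge 0$. The left-hand side is a rational number whose denominator is a power of $2$, hence coprime to $p$; a congruence modulo $p$ between such rationals means that the difference has numerator (in lowest terms) divisible by $p$ and denominator coprime to $p$. -}

module Defs where

open import Algebra.Definitions.RawMonoid using (sum)
open import Data.Fin.Base using (toℕ)
open import Data.Integer.Base as ℤ using (ℤ; +_; 0ℤ)
open import Data.Integer.Divisibility using (_∣_)
open import Data.Integer.GCD using (gcd)
import Data.Integer.Properties as ℤ
open import Data.Nat.Base as ℕ using (ℕ; suc)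
open import Data.Nat.Combinatorics using (_C_)
open import Data.Nat.Coprimality using (Coprime)
open import Data.Product.Base using (_×_)
open import Data.Rational.Base as ℚ using (ℚ; 0ℚ; _/_; _÷_; _-_; ↥_; ↧ₙ_)
import Data.Rational.Properties as ℚ
open import Relation.Binary.PropositionalEquality.Core using (_≡_; _≢_; sym; trans; cong)

franel : ℕ → ℕ
franel n = sum ℕ.+-0-rawMonoid {suc n} λ k → (n C toℕ k) ℕ.^ 3

-16ℤ : ℤ
-16ℤ = ℤ.- (+ 16)

i/1≡0⇒i≡0 : ∀ i → i / 1 ≡ 0ℚ → i ≡ 0ℤ
i/1≡0⇒i≡0 i eq =
  trans (sym (ℚ.↥-/ i 1)) (cong (ℤ._* gcd i (+ 1)) (ℚ.p≡0⇒↥p≡0 (i / 1) eq))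

[-16]^k/1≢0 : ∀ k → (-16ℤ ℤ.^ k) / 1 ≢ 0ℚ
[-16]^k/1≢0 k eq with () ← ℤ.i^n≡0⇒i≡0 -16ℤ k (i/1≡0⇒i≡0 (-16ℤ ℤ.^ k) eq)

summand : ℕ → ℚ
summand k = (+ (((2 ℕ.* k) C k) ℕ.* franel k) / 1) ÷ ((-16ℤ ℤ.^ k) / 1)
  where instance _ = ℚ.≢-nonZero ([-16]^k/1≢0 k)

-- The sum over 0 ≤ k ≤ n - 1.
franelSum : ℕ → ℚ
franelSum n = sum ℚ.+-0-rawMonoid {n} λ k → summand (toℕ k)

infix 4 _≡_[mod_]

-- ↥_ and ↧ₙ_ give the numerator and denominator in lowest terms, since ℚ
-- consists of reduced fractions.
_≡_[mod_] : ℚ → ℚ → ℕ → Set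
x ≡ y [mod p ] = (+ p ∣ ↥ (x - y)) × Coprime (↧ₙ (x - y)) p

{-# OPTIONS --safe #-}
module Submission where

-- Write p = 2m + 1 with m odd. Modulo p we have C(2k,k) ≡ (-4)ᵏ C(m,k), so up to a power of 4 the
-- sum is Σₙ C(m,n) fₙ 4⁻ⁿ. Inserting fₙ = Σᵢ C(n,i) C(i,n-i) C(2i,i) and applying the same
-- congruence to C(2i,i) turns it into Σᵢ (-1)ⁱ C(m,i)² Σₗ C(m-i,l) C(i,l) 4⁻ˡ. The substitution
-- i ↦ m - i changes the sign of every term because m is odd, so this last sum is 0.

open import Defs
open import Algebra.Bundles using (Semiring; module CommutativeRing)
import Algebra.Properties.Semiring.Sum as FinSum
open import Data.Fin.Base using (toℕ)
open import Data.Fin.Permutation using (reverse)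
open import Data.Fin.Properties using (toℕ<n; opposite-prop)
import Data.Integer.Base as ℤ
open import Data.Integer.Divisibility.Signed using (∣⇒∣ᵤ)
import Data.Integer.Properties as ℤ
open import Data.Nat.Base as ℕ using (ℕ; zero; suc; _∸_; _%_; _≤_; _<_; z≤n; s≤s; z<s; s<s; s≤s⁻¹; _!)
-- The library's _C_ binds more weakly than _*_.
open import Data.Nat.Combinatorics renaming (_C_ to infixl 7.5 _C_)
import Data.Nat.Coprimality as Coprimality
import Data.Nat.DivMod as ℕ
import Data.Nat.Divisibility as ℕ
open import Data.Nat.Primality using (Prime; euclidsLemma; prime⇒irreducible; ¬prime[1])
import Data.Nat.Properties as ℕ
open import Data.Nat.Tactic.RingSolver using () renaming (solve-∀ to solveℕ-∀)
open import Data.Product.Base using (_,_)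
open import Data.Rational.Base as ℚ using (0ℚ; 1ℚ; mkℚ; ↥_; ↧_; ↧ₙ_)
import Data.Rational.Properties as ℚ
import Data.Rational.Unnormalised.Base as ℚᵘ
import Data.Rational.Unnormalised.Properties as ℚᵘ
open import Data.Sum.Base using (inj₁; inj₂; [_,_]′)
open import Function.Base using (_∘_; id)
open import Relation.Binary.PropositionalEquality as ≡ using (_≡_)
open import Relation.Nullary.Decidable using (yes; no)
open import Relation.Nullary.Negation using (¬_; contradiction)

-- No inverse modulo `p` is ever formed. With `e = p - 1`, the rational sum is multiplied by
-- (-16)^e, and every congruence is then a divisibility in ℤ. In place of 4⁻ⁿ stands the honest
-- power 4^(2e - n), which is what (-4)^n (-16)^(e - n) equals because `e` is even. The cubes in fₙ
-- show no symmetry that would make the sum cancel. The expansion of fₙ is chosen because it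
-- contains C(2i,i): reducing that factor contributes both the sign (-1)ⁱ and a second C(m,i), while
-- its 4ⁱ cancels the dependence of the weight on i. What is left is symmetric under i ↦ m - i
-- except for the sign.

module RangeSum {c ℓ} (R : Semiring c ℓ) where

  open Semiring R renaming (Carrier to A)
  private
    module Fin = FinSum R

  -- Opaque, so that the unifier can read off f from sum< n f even when n is a successor.
  opaque
    sum< : ℕ → (ℕ → A) → A
    sum< n f = Fin.sum {n} (f ∘ toℕ)

  infixl 10 sum< sum≤

  sum≤ : ℕ → (ℕ → A) → A
  sum≤ n = sum< (suc n)

  syntax sum< n (λ k → x) = ∑[ k < n ] x
  syntax sum≤ n (λ k → x) = ∑[ k ≤ n ] x

  opaque
    unfolding sum<

    sum<-sum : ∀ n (f : ℕ → A) → sum< n f ≡ Fin.sum {n} (f ∘ toℕ)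
    sum<-sum n f = ≡.refl

    ∑-empty : (f : ℕ → A) → ∑[ k < 0 ] f k ≡ 0#
    ∑-empty f = ≡.refl

    ∑-head : ∀ n (f : ℕ → A) → ∑[ k ≤ n ] f k ≡ f 0 + ∑[ k < n ] f (suc k)
    ∑-head n f = ≡.refl

    ∑-cong : ∀ n {f g : ℕ → A} → (∀ k → k < n → f k ≈ g k) → ∑[ k < n ] f k ≈ ∑[ k < n ] g k
    ∑-cong n f≈g = Fin.sum-cong-≋ {n} λ k → f≈g (toℕ k) (toℕ<n k)

    ∑-zero : ∀ n {f : ℕ → A} → (∀ k → k < n → f k ≈ 0#) → ∑[ k < n ] f k ≈ 0#
    ∑-zero n f≈0 = trans (Fin.sum-cong-≋ {n} λ k → f≈0 (toℕ k) (toℕ<n k)) (Fin.sum-replicate-zero n)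

    ∑-distrib-+ : ∀ n (f g : ℕ → A) → ∑[ k < n ] (f k + g k) ≈ ∑[ k < n ] f k + ∑[ k < n ] g k
    ∑-distrib-+ n f g = Fin.∑-distrib-+ {n} (f ∘ toℕ) (g ∘ toℕ)

    *-distribˡ-∑ : ∀ n x (f : ℕ → A) → x * ∑[ k < n ] f k ≈ ∑[ k < n ] (x * f k)
    *-distribˡ-∑ n x f = Fin.*-distribˡ-sum {n} x (f ∘ toℕ)

    ∑-comm : ∀ m n (f : ℕ → ℕ → A) → ∑[ i < m ] ∑[ j < n ] f i j ≈ ∑[ j < n ] ∑[ i < m ] f i j
    ∑-comm m n f = Fin.∑-comm {m} {n} λ i j → f (toℕ i) (toℕ j)

    ∑-reverse : ∀ n (f : ℕ → A) → ∑[ k ≤ n ] f k ≈ ∑[ k ≤ n ] f (n ∸ k)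
    ∑-reverse n f = trans (Fin.sum-permute {suc n} (f ∘ toℕ) reverse)
      (Fin.sum-cong-≋ {suc n} λ k → reflexive (≡.cong f (opposite-prop k)))

    ∑-shift : ∀ i n (f : ℕ → A) → (∀ k → k < i → f k ≈ 0#) → ∑[ k < i ℕ.+ n ] f k ≈ ∑[ k < n ] f (i ℕ.+ k)
    ∑-shift zero    n f f≈0 = refl
    ∑-shift (suc i) n f f≈0 = trans (+-cong (f≈0 0 z<s)
      (∑-shift i n (f ∘ suc) λ k k<i → f≈0 (suc k) (s<s k<i))) (+-identityˡ _)

    ∑-truncate : ∀ m n (f : ℕ → A) → (∀ k → m ≤ k → f k ≈ 0#) → ∑[ k < m ℕ.+ n ] f k ≈ ∑[ k < m ] f k
    ∑-truncate zero    n f f≈0 = ∑-zero n λ k _ → f≈0 k z≤n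
    ∑-truncate (suc m) n f f≈0 = +-congˡ (∑-truncate m n (f ∘ suc) λ k m≤k → f≈0 (suc k) (s≤s m≤k))

module _ {a b ℓ₁ ℓ₂} (R : Semiring a ℓ₁) (S : Semiring b ℓ₂) where
  private
    module R where
      open Semiring R public
      open RangeSum R public
    module S where
      open Semiring S public
      open RangeSum S public

  -- Needed for the two embeddings `+_` of ℕ in ℤ and `_/ 1` of ℤ in ℚ. Only additivity is asked
  -- for. Since `sum<` is opaque, the induction runs through `∑-empty` and `∑-head` instead of
  -- computation.
  ∑-homo : (h : R.Carrier → S.Carrier) → h R.0# ≡ S.0# → (∀ x y → h (x R.+ y) ≡ h x S.+ h y) →
           ∀ n f → h (R.sum< n f) ≡ S.sum< n (h ∘ f)
  ∑-homo h h-0 h-+ zero    f = ≡.trans (≡.cong h (R.∑-empty f)) (≡.trans h-0 (≡.sym (S.∑-empty (h ∘ f))))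
  ∑-homo h h-0 h-+ (suc n) f = begin
    h (R.sum≤ n f)                      ≡⟨ ≡.cong h (R.∑-head n f) ⟩
    h (f 0 R.+ R.sum< n (f ∘ suc))      ≡⟨ h-+ (f 0) _ ⟩
    h (f 0) S.+ h (R.sum< n (f ∘ suc))  ≡⟨ ≡.cong (h (f 0) S.+_) (∑-homo h h-0 h-+ n (f ∘ suc)) ⟩
    h (f 0) S.+ S.sum< n (h ∘ f ∘ suc)  ≡⟨ S.∑-head n (h ∘ f) ⟨
    S.sum≤ n (h ∘ f)                    ∎
    where open ≡.≡-Reasoning

ℚ-semiring : Semiring _ _
ℚ-semiring = CommutativeRing.semiring ℚ.+-*-commutativeRing

module ℕ∑ = RangeSum ℕ.+-*-semiring
module ℤ∑ = RangeSum ℤ.+-*-semiring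
module ℚ∑ = RangeSum ℚ-semiring

-- Binomial identities over ℕ and the expansion of the Franel numbers.

module _ where

  open import Data.Nat.Base using (_+_; _*_; _^_; _/_)
  open import Data.Nat.DivMod using (m/n*n≡m)
  open import Data.Nat.Properties
  open import Data.Nat.Tactic.RingSolver using (solve-∀)
  open ℕ∑
  open ≡
  open ≡-Reasoning

  [m+n]Cm*m!n!≡[m+n]! : ∀ m n → (m + n) C m * (m ! * n !) ≡ (m + n) !
  [m+n]Cm*m!n!≡[m+n]! m n = begin
    (m + n) C m * (m ! * n !)
      ≡⟨ cong (λ j → (m + n) C m * (m ! * j !)) (m+n∸m≡n m n) ⟨
    (m + n) C m * (m ! * (m + n ∸ m) !)
      ≡⟨ cong (_* (m ! * (m + n ∸ m) !)) (nCk≡n!/k![n-k]! m≤m+n′) ⟩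
    (m + n) ! / (m ! * (m + n ∸ m) !) * (m ! * (m + n ∸ m) !)
      ≡⟨ m/n*n≡m (k![n∸k]!∣n! m≤m+n′) ⟩
    (m + n) ! ∎
    where
    m≤m+n′ = m≤m+n m n
    instance _ = m !* (m + n ∸ m) !≢0

  -- Multiplied by `k ! * l ! * j !`, both sides become `(k + (l + j)) !`. Writing the upper index
  -- as a sum of three parts keeps truncated subtraction out of the factorials.
  trinomial-revision : ∀ k l j →
    (k + (l + j)) C (k + l) * ((k + l) C k) ≡ (k + (l + j)) C k * ((l + j) C l)
  trinomial-revision k l j = *-cancelʳ-≡ _ _ (k ! * l ! * j !) (begin
    x * y * (k ! * l ! * j !)               ≡⟨ regroupˡ x y (k !) (l !) (j !) ⟩
    x * ((y * (k ! * l !)) * j !)           ≡⟨ cong (λ a → x * (a * j !)) ([m+n]Cm*m!n!≡[m+n]! k l) ⟩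
    x * ((k + l) ! * j !)                   ≡⟨ cong (λ a → a C (k + l) * ((k + l) ! * j !)) (+-assoc k l j) ⟨
    (k + l + j) C (k + l) * ((k + l) ! * j !) ≡⟨ [m+n]Cm*m!n!≡[m+n]! (k + l) j ⟩
    (k + l + j) !                           ≡⟨ cong _! (+-assoc k l j) ⟩
    (k + (l + j)) !                         ≡⟨ [m+n]Cm*m!n!≡[m+n]! k (l + j) ⟨
    z * (k ! * (l + j) !)                   ≡⟨ cong (λ a → z * (k ! * a)) ([m+n]Cm*m!n!≡[m+n]! l j) ⟨
    z * (k ! * (w * (l ! * j !)))           ≡⟨ regroupʳ z w (k !) (l !) (j !) ⟩
    z * w * (k ! * l ! * j !)               ∎)
    where
    x = (k + (l + j)) C (k + l)
    y = (k + l) C k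
    z = (k + (l + j)) C k
    w = (l + j) C l
    regroupˡ : ∀ x y a b c → x * y * (a * b * c) ≡ x * ((y * (a * b)) * c)
    regroupˡ = solve-∀
    regroupʳ : ∀ z w a b c → z * (a * (w * (b * c))) ≡ z * w * (a * b * c)
    regroupʳ = solve-∀
    instance
      _ = k !* l !≢0
      _ = j !≢0
      _ = m*n≢0 (k ! * l !) (j !)

  -- Out of range both sides are 0, even where `n ∸ k` is truncated, since then `n C k` vanishes.
  -- Having no range hypothesis matters below, where the lower indices may exceed the upper one.
  nC[k+l]*[k+l]Ck≡nCk*[n∸k]Cl : ∀ n k l → n C (k + l) * ((k + l) C k) ≡ n C k * ((n ∸ k) C l)
  nC[k+l]*[k+l]Ck≡nCk*[n∸k]Cl n k l with k + l ≤? n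
  ... | yes k+l≤n = subst (λ n → n C (k + l) * ((k + l) C k) ≡ n C k * ((n ∸ k) C l)) n≡ (begin
    (k + (l + j)) C (k + l) * ((k + l) C k)       ≡⟨ trinomial-revision k l j ⟩
    (k + (l + j)) C k * ((l + j) C l)             ≡⟨ cong (λ a → (k + (l + j)) C k * (a C l)) (m+n∸m≡n k (l + j)) ⟨
    (k + (l + j)) C k * ((k + (l + j) ∸ k) C l)   ∎)
    where
    j = n ∸ (k + l)
    n≡ : k + (l + j) ≡ n
    n≡ = trans (sym (+-assoc k l j)) (m+[n∸m]≡n k+l≤n)
  ... | no k+l≰n with k ≤? n
  ...   | yes k≤n = begin
    n C (k + l) * ((k + l) C k)   ≡⟨ cong (_* ((k + l) C k)) (k>n⇒nCk≡0 (≰⇒> k+l≰n)) ⟩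
    0                             ≡⟨ *-zeroʳ (n C k) ⟨
    n C k * 0                     ≡⟨ cong (n C k *_) (k>n⇒nCk≡0 n∸k<l) ⟨
    n C k * ((n ∸ k) C l)         ∎
    where
    n∸k<l : n ∸ k < l
    n∸k<l = +-cancelˡ-< k (n ∸ k) l (subst (_< k + l) (sym (m+[n∸m]≡n k≤n)) (≰⇒> k+l≰n))
  ...   | no k≰n = begin
    n C (k + l) * ((k + l) C k)   ≡⟨ cong (_* ((k + l) C k)) (k>n⇒nCk≡0 (≰⇒> k+l≰n)) ⟩
    0                             ≡⟨ cong (_* ((n ∸ k) C l)) (k>n⇒nCk≡0 (≰⇒> k≰n)) ⟨
    n C k * ((n ∸ k) C l)         ∎

  vandermonde : ∀ a b r → ∑[ k ≤ r ] (a C k * (b C (r ∸ k))) ≡ (a + b) C r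
  vandermonde zero b r = begin
    ∑[ k ≤ r ] (0 C k * (b C (r ∸ k)))
      ≡⟨ ∑-head r _ ⟩
    1 * (b C r) + ∑[ k < r ] (0 C suc k * (b C (r ∸ suc k)))
      ≡⟨ cong₂ _+_ (*-identityˡ (b C r)) (∑-zero r λ k _ → refl) ⟩
    b C r + 0
      ≡⟨ +-identityʳ (b C r) ⟩
    b C r ∎
  vandermonde (suc a) b zero = trans (∑-head 0 _) (cong (1 +_) (∑-empty _))
  vandermonde (suc a) b (suc r) = begin
    ∑[ k ≤ suc r ] (suc a C k * (b C (suc r ∸ k)))
      ≡⟨ ∑-head (suc r) _ ⟩
    1 * (b C suc r) + ∑[ k ≤ r ] (suc a C suc k * (b C (r ∸ k)))
      ≡⟨ cong (1 * (b C suc r) +_) (trans (∑-cong (suc r) step) (∑-distrib-+ (suc r) _ _)) ⟩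
    1 * (b C suc r) + (∑[ k ≤ r ] (a C k * (b C (r ∸ k))) + t)
      -- The split-off head is exactly the missing `k = 0` term of `t`: together they form the
      -- Vandermonde sum for `a` and `suc r`.
      ≡⟨ x+[y+z]≡y+[x+z] (1 * (b C suc r)) _ t ⟩
    ∑[ k ≤ r ] (a C k * (b C (r ∸ k))) + (1 * (b C suc r) + t)
      ≡⟨ cong₂ _+_ (vandermonde a b r) (trans (sym (∑-head (suc r) _)) (vandermonde a b (suc r))) ⟩
    (a + b) C r + (a + b) C suc r
      ≡⟨ nCk+nC[k+1]≡[n+1]C[k+1] (a + b) r ⟩
    (suc a + b) C suc r ∎
    where
    t = ∑[ k ≤ r ] (a C suc k * (b C (r ∸ k)))
    step : ∀ k → k < suc r → suc a C suc k * (b C (r ∸ k)) ≡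
             a C k * (b C (r ∸ k)) + a C suc k * (b C (r ∸ k))
    step k _ = trans (cong (_* (b C (r ∸ k))) (sym (nCk+nC[k+1]≡[n+1]C[k+1] a k)))
                   (*-distribʳ-+ (b C (r ∸ k)) (a C k) (a C suc k))
    x+[y+z]≡y+[x+z] : ∀ x y z → x + (y + z) ≡ y + (x + z)
    x+[y+z]≡y+[x+z] = solve-∀

  -- Count the pairs of a k-subset and an (n ∸ k)-subset of an n-set by the size i of their union.
  nCk*nCk≡∑ : ∀ n k → k ≤ n →
    n C k * (n C k) ≡ ∑[ i ≤ n ] (n C i * (i C k) * (k C (n ∸ i)))
  nCk*nCk≡∑ n k k≤n = sym (begin
    ∑[ i ≤ n ] h i
      ≡⟨ cong (λ N → ∑[ i < N ] h i) 1+n≡ ⟩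
    ∑[ i < k + suc (n ∸ k) ] h i
      ≡⟨ ∑-shift k (suc (n ∸ k)) h h≡0 ⟩
    ∑[ l ≤ n ∸ k ] h (k + l)
      ≡⟨ ∑-cong (suc (n ∸ k)) step ⟩
    ∑[ l ≤ n ∸ k ] (n C k * ((n ∸ k) C l * (k C (n ∸ k ∸ l))))
      ≡⟨ *-distribˡ-∑ (suc (n ∸ k)) (n C k) _ ⟨
    n C k * ∑[ l ≤ n ∸ k ] ((n ∸ k) C l * (k C (n ∸ k ∸ l)))
      ≡⟨ cong (n C k *_) (vandermonde (n ∸ k) k (n ∸ k)) ⟩
    n C k * ((n ∸ k + k) C (n ∸ k))
      ≡⟨ cong (λ a → n C k * (a C (n ∸ k))) (m∸n+n≡m k≤n) ⟩
    n C k * (n C (n ∸ k))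
      ≡⟨ cong (n C k *_) (nCk≡nC[n∸k] k≤n) ⟨
    n C k * (n C k) ∎)
    where
    h : ℕ → ℕ
    h i = n C i * (i C k) * (k C (n ∸ i))
    1+n≡ : suc n ≡ k + suc (n ∸ k)
    1+n≡ = sym (trans (+-suc k (n ∸ k)) (cong suc (m+[n∸m]≡n k≤n)))
    h≡0 : ∀ i → i < k → h i ≡ 0
    h≡0 i i<k = cong (_* (k C (n ∸ i)))
      (trans (cong (n C i *_) (k>n⇒nCk≡0 i<k)) (*-zeroʳ (n C i)))
    step : ∀ l → l < suc (n ∸ k) → h (k + l) ≡ n C k * ((n ∸ k) C l * (k C (n ∸ k ∸ l)))
    step l _ = trans
      (cong₂ _*_ (nC[k+l]*[k+l]Ck≡nCk*[n∸k]Cl n k l) (cong (k C_) (sym (∸-+-assoc n k l))))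
      (*-assoc (n C k) _ _)

  -- Put `d = n ∸ i` and `k = d + l`. Trinomial revision extracts `i C d`, symmetry turns
  -- `n C (d + l)` into `n C (i ∸ l)`, and a Vandermonde sum over `l` remains.
  ∑nCk*iCk*kC[n∸i] : ∀ n i → i ≤ n →
    ∑[ k ≤ n ] (n C k * (i C k * (k C (n ∸ i)))) ≡ i C (n ∸ i) * ((2 * i) C i)
  ∑nCk*iCk*kC[n∸i] n i i≤n = begin
    ∑[ k ≤ n ] h k
      ≡⟨ cong (λ N → ∑[ k < N ] h k) 1+n≡ ⟩
    ∑[ k < d + suc i ] h k
      ≡⟨ ∑-shift d (suc i) h h≡0 ⟩
    ∑[ l ≤ i ] h (d + l)
      ≡⟨ ∑-cong (suc i) step ⟩
    ∑[ l ≤ i ] (i C d * ((i ∸ d) C l * (n C (i ∸ l))))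
      ≡⟨ *-distribˡ-∑ (suc i) (i C d) _ ⟨
    i C d * ∑[ l ≤ i ] ((i ∸ d) C l * (n C (i ∸ l)))
      ≡⟨ cong (i C d *_) (vandermonde (i ∸ d) n i) ⟩
    i C d * ((i ∸ d + n) C i)
      ≡⟨ last ⟩
    i C d * ((2 * i) C i) ∎
    where
    d = n ∸ i
    h : ℕ → ℕ
    h k = n C k * (i C k * (k C d))
    d+i≡n : d + i ≡ n
    d+i≡n = m∸n+n≡m i≤n
    1+n≡ : suc n ≡ d + suc i
    1+n≡ = sym (trans (+-suc d i) (cong suc d+i≡n))
    h≡0 : ∀ k → k < d → h k ≡ 0
    h≡0 k k<d = trans (cong (λ a → n C k * (i C k * a)) (k>n⇒nCk≡0 k<d))
      (trans (cong (n C k *_) (*-zeroʳ (i C k))) (*-zeroʳ (n C k)))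
    complement : ∀ l → l ≤ i → n C (d + l) ≡ n C (i ∸ l)
    complement l l≤i = trans
      (nCk≡nC[n∸k] (subst (d + l ≤_) d+i≡n (+-monoʳ-≤ d l≤i)))
      (cong (n C_) (trans (cong (_∸ (d + l)) (sym d+i≡n)) ([m+n]∸[m+o]≡n∸o d i l)))
    step : ∀ l → l < suc i → h (d + l) ≡ i C d * ((i ∸ d) C l * (n C (i ∸ l)))
    step l l<1+i = begin
      n C (d + l) * (i C (d + l) * ((d + l) C d))
        ≡⟨ cong₂ _*_ (complement l (s≤s⁻¹ l<1+i)) (nC[k+l]*[k+l]Ck≡nCk*[n∸k]Cl i d l) ⟩
      n C (i ∸ l) * (i C d * ((i ∸ d) C l))
        ≡⟨ *-comm (n C (i ∸ l)) _ ⟩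
      i C d * ((i ∸ d) C l) * (n C (i ∸ l))
        ≡⟨ *-assoc (i C d) _ _ ⟩
      i C d * ((i ∸ d) C l * (n C (i ∸ l))) ∎
    -- The equality `i ∸ d + n = 2 * i` requires `d ≤ i`. Otherwise the subtraction truncates, but
    -- the factor `i C d` is 0.
    last : i C d * ((i ∸ d + n) C i) ≡ i C d * ((2 * i) C i)
    last with d ≤? i
    ... | yes d≤i = cong (λ a → i C d * (a C i)) (begin
      i ∸ d + n        ≡⟨ cong (i ∸ d +_) d+i≡n ⟨
      i ∸ d + (d + i)  ≡⟨ +-assoc (i ∸ d) d i ⟨
      i ∸ d + d + i    ≡⟨ cong (_+ i) (m∸n+n≡m d≤i) ⟩
      i + i            ≡⟨ cong (i +_) (+-identityʳ i) ⟨
      2 * i            ∎)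
    ... | no d≰i rewrite k>n⇒nCk≡0 (≰⇒> d≰i) = refl

  -- Two of the three factors of each cube are expanded by `nCk*nCk≡∑`. After exchanging the sums,
  -- the sum over `k` has a closed form.
  franel≡∑ : ∀ n → franel n ≡ ∑[ i ≤ n ] (n C i * (i C (n ∸ i) * ((2 * i) C i)))
  franel≡∑ n = begin
    franel n
      ≡⟨ sum<-sum (suc n) (λ k → (n C k) ^ 3) ⟨
    ∑[ k ≤ n ] ((n C k) ^ 3)
      ≡⟨ ∑-cong (suc n) expand ⟩
    ∑[ k ≤ n ] ∑[ i ≤ n ] (n C i * (n C k * (i C k * (k C (n ∸ i)))))
      ≡⟨ ∑-comm (suc n) (suc n) _ ⟩
    ∑[ i ≤ n ] ∑[ k ≤ n ] (n C i * (n C k * (i C k * (k C (n ∸ i)))))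
      ≡⟨ ∑-cong (suc n) (λ i i<1+n → trans
           (sym (*-distribˡ-∑ (suc n) (n C i) _))
           (cong (n C i *_) (∑nCk*iCk*kC[n∸i] n i (s≤s⁻¹ i<1+n)))) ⟩
    ∑[ i ≤ n ] (n C i * (i C (n ∸ i) * ((2 * i) C i))) ∎
    where
    cube : ∀ x → x * (x * (x * 1)) ≡ x * (x * x)
    cube = solve-∀
    regroup : ∀ a b c d → a * (b * c * d) ≡ b * (a * (c * d))
    regroup = solve-∀
    expand : ∀ k → k < suc n → (n C k) ^ 3 ≡
      ∑[ i ≤ n ] (n C i * (n C k * (i C k * (k C (n ∸ i)))))
    expand k k<1+n = begin
      (n C k) ^ 3
        ≡⟨ cube (n C k) ⟩
      n C k * (n C k * (n C k))
        ≡⟨ cong (n C k *_) (nCk*nCk≡∑ n k (s≤s⁻¹ k<1+n)) ⟩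
      n C k * ∑[ i ≤ n ] (n C i * (i C k) * (k C (n ∸ i)))
        ≡⟨ *-distribˡ-∑ (suc n) (n C k) _ ⟩
      ∑[ i ≤ n ] (n C k * (n C i * (i C k) * (k C (n ∸ i))))
        ≡⟨ ∑-cong (suc n) (λ i _ → regroup (n C k) (n C i) _ _) ⟩
      ∑[ i ≤ n ] (n C i * (n C k * (i C k * (k C (n ∸ i))))) ∎

  -- With `n = i + l`, trinomial revision replaces `m C n * (n C i)` by `m C i * ((m ∸ i) C l)`. The
  -- inner range is padded with zero terms up to `m`, so that it does not depend on `i` and the sums
  -- at `i` and `m ∸ i` can be compared term by term.
  ∑w*mCn*franel : ∀ m (w : ℕ → ℕ) →
    ∑[ n ≤ m ] (w n * (m C n * franel n)) ≡
    ∑[ i ≤ m ] (m C i * ((2 * i) C i) *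
      ∑[ l ≤ m ] ((m ∸ i) C l * (i C l) * w (i + l)))
  ∑w*mCn*franel m w = begin
    ∑[ n ≤ m ] (w n * (m C n * franel n))
      ≡⟨ ∑-cong (suc m) (λ n n<1+m → expand n (s≤s⁻¹ n<1+m)) ⟩
    ∑[ n ≤ m ] ∑[ i ≤ m ] (c i * h i n)
      ≡⟨ ∑-comm (suc m) (suc m) _ ⟩
    ∑[ i ≤ m ] ∑[ n ≤ m ] (c i * h i n)
      ≡⟨ ∑-cong (suc m) (λ i i<1+m → collect i (s≤s⁻¹ i<1+m)) ⟩
    ∑[ i ≤ m ] (m C i * c i * ∑[ l ≤ m ] u i l) ∎
    where
    c : ℕ → ℕ
    c i = (2 * i) C i
    h : ℕ → ℕ → ℕ
    h i n = w n * (m C n * (n C i)) * (i C (n ∸ i))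
    u : ℕ → ℕ → ℕ
    u i l = (m ∸ i) C l * (i C l) * w (i + l)
    regroup₁ : ∀ a b x y z → a * b * (x * (y * z)) ≡ z * (a * (b * x) * y)
    regroup₁ = solve-∀
    regroup₂ : ∀ a b c d → a * (b * c) * d ≡ b * (c * d * a)
    regroup₂ = solve-∀
    regroup₃ : ∀ a b c → a * (b * c) ≡ b * a * c
    regroup₃ = solve-∀
    expand : ∀ n → n ≤ m → w n * (m C n * franel n) ≡ ∑[ i ≤ m ] (c i * h i n)
    expand n n≤m = begin
      w n * (m C n * franel n)
        ≡⟨ *-assoc (w n) (m C n) (franel n) ⟨
      w n * (m C n) * franel n
        ≡⟨ cong (w n * (m C n) *_) (franel≡∑ n) ⟩
      w n * (m C n) * ∑[ i ≤ n ] (n C i * (i C (n ∸ i) * c i))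
        ≡⟨ *-distribˡ-∑ (suc n) (w n * (m C n)) _ ⟩
      ∑[ i ≤ n ] (w n * (m C n) * (n C i * (i C (n ∸ i) * c i)))
        ≡⟨ ∑-cong (suc n) (λ i _ → regroup₁ (w n) (m C n) (n C i) _ (c i)) ⟩
      ∑[ i ≤ n ] (c i * h i n)
        -- Exchanging the sums needs a rectangular range; the added terms have `i > n`, where
        -- `n C i` is 0.
        ≡⟨ ∑-truncate (suc n) (m ∸ n) (λ i → c i * h i n) vanish ⟨
      ∑[ i < suc n + (m ∸ n) ] (c i * h i n)
        ≡⟨ cong (λ N → ∑[ i < suc N ] (c i * h i n)) (m+[n∸m]≡n n≤m) ⟩
      ∑[ i ≤ m ] (c i * h i n) ∎
      where
      vanish : ∀ i → n < i → c i * h i n ≡ 0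
      vanish i n<i = begin
        c i * (w n * (m C n * (n C i)) * (i C (n ∸ i)))
          ≡⟨ cong (λ a → c i * (w n * (m C n * a) * (i C (n ∸ i)))) (k>n⇒nCk≡0 n<i) ⟩
        c i * (w n * (m C n * 0) * (i C (n ∸ i)))
          ≡⟨ zeros (c i) (w n) (m C n) (i C (n ∸ i)) ⟩
        0 ∎
        where
        zeros : ∀ a b c d → a * (b * (c * 0) * d) ≡ 0
        zeros = solve-∀
    collect : ∀ i → i ≤ m → ∑[ n ≤ m ] (c i * h i n) ≡ m C i * c i * ∑[ l ≤ m ] u i l
    collect i i≤m = begin
      ∑[ n ≤ m ] (c i * h i n)
        ≡⟨ *-distribˡ-∑ (suc m) (c i) _ ⟨
      c i * ∑[ n ≤ m ] h i n
        ≡⟨ cong (λ N → c i * ∑[ n < N ] h i n) 1+m≡ ⟩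
      c i * ∑[ n < i + suc (m ∸ i) ] h i n
        ≡⟨ cong (c i *_) (∑-shift i (suc (m ∸ i)) (h i) h≡0) ⟩
      c i * ∑[ l ≤ m ∸ i ] h i (i + l)
        ≡⟨ cong (c i *_) (∑-cong (suc (m ∸ i)) (λ l _ → step l)) ⟩
      c i * ∑[ l ≤ m ∸ i ] (m C i * u i l)
        ≡⟨ cong (c i *_) (*-distribˡ-∑ (suc (m ∸ i)) (m C i) _) ⟨
      c i * (m C i * ∑[ l ≤ m ∸ i ] u i l)
        ≡⟨ cong (λ s → c i * (m C i * s)) (∑-truncate (suc (m ∸ i)) i (u i) u≡0) ⟨
      c i * (m C i * ∑[ l < suc (m ∸ i) + i ] u i l)
        ≡⟨ cong (λ N → c i * (m C i * ∑[ l < suc N ] u i l)) (m∸n+n≡m i≤m) ⟩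
      c i * (m C i * ∑[ l ≤ m ] u i l)
        ≡⟨ regroup₃ (c i) (m C i) _ ⟩
      m C i * c i * ∑[ l ≤ m ] u i l ∎
      where
      1+m≡ : suc m ≡ i + suc (m ∸ i)
      1+m≡ = sym (trans (+-suc i (m ∸ i)) (cong suc (m+[n∸m]≡n i≤m)))
      h≡0 : ∀ n → n < i → h i n ≡ 0
      h≡0 n n<i = trans (cong (λ a → w n * (m C n * a) * (i C (n ∸ i))) (k>n⇒nCk≡0 n<i))
                        (zeros (w n) (m C n) (i C (n ∸ i)))
        where
        zeros : ∀ a b c → a * (b * 0) * c ≡ 0
        zeros = solve-∀
      u≡0 : ∀ l → m ∸ i < l → u i l ≡ 0
      u≡0 l m∸i<l = cong (λ a → a * (i C l) * w (i + l)) (k>n⇒nCk≡0 m∸i<l)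
      step : ∀ l → h i (i + l) ≡ m C i * u i l
      step l = begin
        w (i + l) * (m C (i + l) * ((i + l) C i)) * (i C (i + l ∸ i))
          ≡⟨ cong₂ (λ a b → w (i + l) * a * (i C b)) (nC[k+l]*[k+l]Ck≡nCk*[n∸k]Cl m i l) (m+n∸m≡n i l) ⟩
        w (i + l) * (m C i * ((m ∸ i) C l)) * (i C l)
          ≡⟨ regroup₂ (w (i + l)) (m C i) ((m ∸ i) C l) (i C l) ⟩
        m C i * u i l ∎

  -- The absorption identity is trinomial revision with a distinguished subset of size 1.
  [1+k]*[1+n]C[1+k]≡[1+n]*nCk : ∀ n k → suc k * (suc n C suc k) ≡ suc n * (n C k)
  [1+k]*[1+n]C[1+k]≡[1+n]*nCk n k = begin
    suc k * (suc n C suc k)        ≡⟨ *-comm (suc k) (suc n C suc k) ⟩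
    suc n C suc k * suc k          ≡⟨ cong (suc n C suc k *_) (nC1≡n (suc k)) ⟨
    suc n C suc k * (suc k C 1)    ≡⟨ nC[k+l]*[k+l]Ck≡nCk*[n∸k]Cl (suc n) 1 k ⟩
    suc n C 1 * (n C k)            ≡⟨ cong (_* (n C k)) (nC1≡n (suc n)) ⟩
    suc n * (n C k)                ∎

  -- This is (k+1) C(n,k+1) = (n-k) C(n,k) freed of subtraction, so it also holds for `k > n`.
  [1+k]*nC[1+k]+k*nCk≡n*nCk : ∀ n k → suc k * (n C suc k) + k * (n C k) ≡ n * (n C k)
  [1+k]*nC[1+k]+k*nCk≡n*nCk n k = +-cancelˡ-≡ (n C k) _ _ (begin
    n C k + (suc k * (n C suc k) + k * (n C k))  ≡⟨ regroup k (n C k) (n C suc k) ⟩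
    suc k * (n C k + n C suc k)                  ≡⟨ cong (suc k *_) (nCk+nC[k+1]≡[n+1]C[k+1] n k) ⟩
    suc k * (suc n C suc k)                      ≡⟨ [1+k]*[1+n]C[1+k]≡[1+n]*nCk n k ⟩
    suc n * (n C k)                              ∎)
    where
    regroup : ∀ k x y → x + (suc k * y + k * x) ≡ suc k * (x + y)
    regroup = solve-∀

  -- Pascal's rule splits the new central binomial into two entries that are equal by symmetry, and
  -- absorption then applies to one of them.
  [1+n]*[2+2n]C[1+n] : ∀ n → suc n * ((2 * suc n) C suc n) ≡ 2 * suc (2 * n) * ((2 * n) C n)
  [1+n]*[2+2n]C[1+n] n = begin
    suc n * ((2 * suc n) C suc n)                    ≡⟨ cong (λ a → suc n * (a C suc n)) (2*[1+n] n) ⟩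
    suc n * (suc (suc (2 * n)) C suc n)              ≡⟨ cong (suc n *_) (nCk+nC[k+1]≡[n+1]C[k+1] (suc (2 * n)) n) ⟨
    suc n * (suc (2 * n) C n + suc (2 * n) C suc n)  ≡⟨ cong (λ a → suc n * (a + suc (2 * n) C suc n)) symmetric ⟩
    suc n * (suc (2 * n) C suc n + suc (2 * n) C suc n)
      ≡⟨ double (suc n) (suc (2 * n) C suc n) ⟩
    2 * (suc n * (suc (2 * n) C suc n))              ≡⟨ cong (2 *_) ([1+k]*[1+n]C[1+k]≡[1+n]*nCk (2 * n) n) ⟩
    2 * (suc (2 * n) * ((2 * n) C n))                ≡⟨ *-assoc 2 (suc (2 * n)) _ ⟨
    2 * suc (2 * n) * ((2 * n) C n)                  ∎
    where
    2*[1+n] : ∀ n → 2 * suc n ≡ suc (suc (2 * n))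
    2*[1+n] = solve-∀
    double : ∀ a b → a * (b + b) ≡ 2 * (a * b)
    double = solve-∀
    symmetric : suc (2 * n) C n ≡ suc (2 * n) C suc n
    symmetric = sym (trans (nCk≡nC[n∸k] (s≤s (m≤n*m n 2)))
      (cong (suc (2 * n) C_) (trans (m+n∸m≡n n (n + 0)) (+-identityʳ n))))

-- Congruences modulo `p` over ℤ.

module _ where

  open import Data.Integer.Base using (ℤ; +_; -_; _+_; _-_; _*_; _^_; -1ℤ; 0ℤ; 1ℤ)
  open import Data.Integer.Coprimality using (coprime-divisor)
  open import Data.Integer.Divisibility.Signed
  open import Data.Integer.Properties
  open import Data.Integer.Tactic.RingSolver using (solve-∀)
  open ℤ∑
  open ≡
  open ≡-Reasoning

  ∑-pos : ∀ n f → + ℕ∑.sum< n f ≡ ∑[ k < n ] (+ f k)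
  ∑-pos = ∑-homo ℕ.+-*-semiring ℤ.+-*-semiring +_ refl pos-+

  ∣∑ : ∀ {d} n {f : ℕ → ℤ} → (∀ k → k < n → d ∣ f k) → d ∣ ∑[ k < n ] f k
  ∣∑ {d} zero    d∣f = subst (d ∣_) (sym (∑-empty _)) (divides 0ℤ refl)
  ∣∑ {d} (suc n) d∣f = subst (d ∣_) (sym (∑-head n _))
    (∣m∣n⇒∣m+n (d∣f 0 z<s) (∣∑ n λ k k<n → d∣f (suc k) (s<s k<n)))

  ∣∑-resp-≡mod : ∀ {d} n {f g : ℕ → ℤ} → (∀ k → k < n → d ∣ f k - g k) →
                 d ∣ ∑[ k < n ] g k → d ∣ ∑[ k < n ] f k
  ∣∑-resp-≡mod {d} n {f} {g} d∣f-g d∣∑g = subst (d ∣_)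
    (trans (sym (∑-distrib-+ n _ g)) (∑-cong n λ k _ → i-j+j≡i (f k) (g k)))
    (∣m∣n⇒∣m+n (∣∑ n d∣f-g) d∣∑g)
    where
    i-j+j≡i : ∀ i j → i - j + j ≡ i
    i-j+j≡i = solve-∀

  ^-distribʳ-* : ∀ n i j → (i * j) ^ n ≡ i ^ n * j ^ n
  ^-distribʳ-* zero    i j = refl
  ^-distribʳ-* (suc n) i j = trans (cong (i * j *_) (^-distribʳ-* n i j)) (interchange i j (i ^ n) (j ^ n))
    where
    interchange : ∀ a b c d → a * b * (c * d) ≡ a * c * (b * d)
    interchange = solve-∀

  pos-^ : ∀ m n → + (m ℕ.^ n) ≡ (+ m) ^ n
  pos-^ m zero    = refl
  pos-^ m (suc n) = trans (pos-* m (m ℕ.^ n)) (cong ((+ m) *_) (pos-^ m n))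

  -1^[n+n]≡1 : ∀ n → -1ℤ ^ (n ℕ.+ n) ≡ 1ℤ
  -1^[n+n]≡1 n = begin
    -1ℤ ^ (n ℕ.+ n)     ≡⟨ ^-distribˡ-+-* -1ℤ n n ⟩
    -1ℤ ^ n * -1ℤ ^ n   ≡⟨ ^-distribʳ-* n -1ℤ -1ℤ ⟨
    1ℤ ^ n              ≡⟨ ^-zeroˡ n ⟩
    1ℤ                  ∎

  -4ℤ : ℤ
  -4ℤ = - (+ 4)

  -4^n≡-1^n*4^n : ∀ n → -4ℤ ^ n ≡ -1ℤ ^ n * + (4 ℕ.^ n)
  -4^n≡-1^n*4^n n = trans (^-distribʳ-* n -1ℤ (+ 4)) (cong ((-1ℤ ^ n) *_) (sym (pos-^ 4 n)))

  -- In characteristic p = 2m + 1 we have m = -1/2, and C(-1/2, n) = C(2n, n) / (-4)ⁿ.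
  [2n]Cn≡-4^n*mCn : ∀ m → Prime (suc (m ℕ.+ m)) → ∀ n → n < suc (m ℕ.+ m) →
    + suc (m ℕ.+ m) ∣ + ((2 ℕ.* n) C n) - -4ℤ ^ n * + (m C n)
  [2n]Cn≡-4^n*mCn m p-prime zero    _ = divides 0ℤ refl
  -- The recurrence controls only `suc n` times the new difference; `suc n < p` makes this factor
  -- coprime to `p`, so it can be cancelled.
  [2n]Cn≡-4^n*mCn m p-prime (suc n) 1+n<p = ∣ᵤ⇒∣ (coprime-divisor (+ p) (+ suc n) D′
    (Coprimality.prime⇒coprime p-prime 1+n<p)
    (∣⇒∣ᵤ (subst (+ p ∣_) (sym recurrence)
      (∣m∣n⇒∣m+n (∣n⇒∣m*n (+ 2 * c) (∣-refl {x = + p}))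
                 (∣n⇒∣m*n (-4ℤ * (+ m - + n)) ([2n]Cn≡-4^n*mCn m p-prime n (ℕ.<-trans (ℕ.n<1+n n) 1+n<p)))))))
    where
    p = suc (m ℕ.+ m)
    q = -4ℤ ^ n
    c = + ((2 ℕ.* n) C n)
    c′ = + ((2 ℕ.* suc n) C suc n)
    b = + (m C n)
    b′ = + (m C suc n)
    D′ = c′ - -4ℤ * q * b′
    c-step : + suc n * c′ ≡ + 2 * (1ℤ + + 2 * + n) * c
    c-step = begin
      + suc n * c′
        ≡⟨ pos-* (suc n) _ ⟨
      + (suc n ℕ.* ((2 ℕ.* suc n) C suc n))
        ≡⟨ cong +_ ([1+n]*[2+2n]C[1+n] n) ⟩
      + (2 ℕ.* suc (2 ℕ.* n) ℕ.* ((2 ℕ.* n) C n))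
        ≡⟨ pos-* (2 ℕ.* suc (2 ℕ.* n)) _ ⟩
      + (2 ℕ.* suc (2 ℕ.* n)) * c
        ≡⟨ cong (_* c) (pos-* 2 (suc (2 ℕ.* n))) ⟩
      + 2 * (1ℤ + + (2 ℕ.* n)) * c
        ≡⟨ cong (λ a → + 2 * (1ℤ + a) * c) (pos-* 2 n) ⟩
      + 2 * (1ℤ + + 2 * + n) * c ∎
    b-step : + suc n * b′ + + n * b ≡ + m * b
    b-step = begin
      + suc n * b′ + + n * b
        ≡⟨ cong₂ _+_ (pos-* (suc n) _) (pos-* n _) ⟨
      + (suc n ℕ.* (m C suc n)) + + (n ℕ.* (m C n))
        ≡⟨ pos-+ (suc n ℕ.* (m C suc n)) _ ⟨
      + (suc n ℕ.* (m C suc n) ℕ.+ n ℕ.* (m C n))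
        ≡⟨ cong +_ ([1+k]*nC[1+k]+k*nCk≡n*nCk m n) ⟩
      + (m ℕ.* (m C n))
        ≡⟨ pos-* m _ ⟩
      + m * b ∎
    expandˡ : ∀ s c′ q b b′ n → s * (c′ - -4ℤ * q * b′) ≡ s * c′ + + 4 * q * (s * b′ + n * b - n * b)
    expandˡ = solve-∀
    expandʳ : ∀ m n c q b → + 2 * (1ℤ + + 2 * n) * c + + 4 * q * (m * b - n * b) ≡
                            + 2 * c * (1ℤ + (m + m)) + -4ℤ * (m - n) * (c - q * b)
    expandʳ = solve-∀
    -- As 2(2n+1) = 2p - 4(m-n), both sequences satisfy (n+1) x(n+1) ≡ -4(m-n) x(n) modulo `p`, and
    -- hence so does their difference.
    recurrence : + suc n * D′ ≡ + 2 * c * + p + -4ℤ * (+ m - + n) * (c - q * b)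
    recurrence = begin
      + suc n * D′
        ≡⟨ expandˡ (+ suc n) c′ q b b′ (+ n) ⟩
      + suc n * c′ + + 4 * q * (+ suc n * b′ + + n * b - + n * b)
        ≡⟨ cong₂ (λ x y → x + + 4 * q * (y - + n * b)) c-step b-step ⟩
      + 2 * (1ℤ + + 2 * + n) * c + + 4 * q * (+ m * b - + n * b)
        ≡⟨ expandʳ (+ m) (+ n) c q b ⟩
      + 2 * c * + p + -4ℤ * (+ m - + n) * (c - q * b) ∎

  i≡-i⇒i≡0 : ∀ {i} → i ≡ - i → i ≡ 0ℤ
  -- For nonzero `i` the two sides have different constructors, so no other case arises.
  i≡-i⇒i≡0 {+ zero} _ = refl

  ∑-antisymmetric : ∀ m (f : ℕ → ℤ) → (∀ i → i ≤ m → f (m ∸ i) ≡ - f i) → ∑[ i ≤ m ] f i ≡ 0ℤ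
  ∑-antisymmetric m f anti = i≡-i⇒i≡0 (begin
    ∑[ i ≤ m ] f i          ≡⟨ ∑-reverse m f ⟩
    ∑[ i ≤ m ] f (m ∸ i)    ≡⟨ ∑-cong (suc m) (λ i i<1+m → trans (anti i (s≤s⁻¹ i<1+m)) (sym (-1*i≡-i (f i)))) ⟩
    ∑[ i ≤ m ] (-1ℤ * f i)  ≡⟨ *-distribˡ-∑ (suc m) -1ℤ f ⟨
    -1ℤ * ∑[ i ≤ m ] f i    ≡⟨ -1*i≡-i _ ⟩
    - ∑[ i ≤ m ] f i        ∎)

  -- This is (-16)^e times `franelSum (suc e)`, with the denominators cleared.
  scaledFranelSum : ℕ → ℤ
  scaledFranelSum e = ∑[ k ≤ e ] (+ ((2 ℕ.* k) C k ℕ.* franel k) * -16ℤ ^ (e ∸ k))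

  -- The prime is 4h + 3, spelled as `suc (m + m)` with `m = suc (h + h)`, so that the oddness of
  -- `m` is visible by computation.
  module Congruence (h : ℕ) (p-prime : Prime (suc (suc (h ℕ.+ h) ℕ.+ suc (h ℕ.+ h)))) where

    m e p : ℕ
    m = suc (h ℕ.+ h)
    e = m ℕ.+ m
    p = suc e

    -- All indices stay below 2e, so the subtraction is never truncated.
    w : ℕ → ℕ
    w k = 4 ℕ.^ (e ℕ.+ e ∸ k)

    c : ℕ → ℕ
    c k = (2 ℕ.* k) C k

    -- `U` is the inner sum of `∑w*mCn*franel`. `V` is `U` times 4ⁱ: its weight no longer involves
    -- `i`, which makes it invariant under `i ↦ m ∸ i`.
    U V : ℕ → ℕ
    U i = ℕ∑.sum≤ m λ l → (m ∸ i) C l ℕ.* (i C l) ℕ.* w (i ℕ.+ l)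
    V i = ℕ∑.sum≤ m λ l → (m ∸ i) C l ℕ.* (i C l) ℕ.* w l

    4^i*w : ∀ {i l} → i ≤ m → l ≤ m → 4 ℕ.^ i ℕ.* w (i ℕ.+ l) ≡ w l
    4^i*w {i} {l} i≤m l≤m = begin
      4 ℕ.^ i ℕ.* 4 ℕ.^ (e ℕ.+ e ∸ (i ℕ.+ l))  ≡⟨ ℕ.^-distribˡ-+-* 4 i _ ⟨
      4 ℕ.^ (i ℕ.+ (e ℕ.+ e ∸ (i ℕ.+ l)))      ≡⟨ cong (4 ℕ.^_) (ℕ.+-∸-assoc i i+l≤2e) ⟨
      4 ℕ.^ (i ℕ.+ (e ℕ.+ e) ∸ (i ℕ.+ l))      ≡⟨ cong (4 ℕ.^_) (ℕ.[m+n]∸[m+o]≡n∸o i (e ℕ.+ e) l) ⟩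
      w l                                      ∎
      where
      i+l≤2e : i ℕ.+ l ≤ e ℕ.+ e
      i+l≤2e = ℕ.≤-trans (ℕ.+-mono-≤ i≤m l≤m) (ℕ.m≤m+n e e)

    4^i*U≡V : ∀ {i} → i ≤ m → 4 ℕ.^ i ℕ.* U i ≡ V i
    4^i*U≡V {i} i≤m = trans (ℕ∑.*-distribˡ-∑ (suc m) (4 ℕ.^ i) _)
      (ℕ∑.∑-cong (suc m) λ l l<1+m → trans (swap (4 ℕ.^ i) ((m ∸ i) C l ℕ.* (i C l)) _)
        (cong ((m ∸ i) C l ℕ.* (i C l) ℕ.*_) (4^i*w i≤m (s≤s⁻¹ l<1+m))))
      where
      swap : ∀ a b c → a ℕ.* (b ℕ.* c) ≡ b ℕ.* (a ℕ.* c)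
      swap = solveℕ-∀

    V-symmetric : ∀ {i} → i ≤ m → V (m ∸ i) ≡ V i
    V-symmetric {i} i≤m = ℕ∑.∑-cong (suc m) λ l _ → cong (ℕ._* w l)
      (trans (cong (λ j → j C l ℕ.* ((m ∸ i) C l)) (ℕ.m∸[m∸n]≡n i≤m)) (ℕ.*-comm (i C l) _))

    -- The residue of `m C i * c i * U i` once `c i` is replaced by (-4)ⁱ C(m,i), with 4ⁱ absorbed
    -- into `V`.
    T : ℕ → ℤ
    T i = -1ℤ ^ i * + (m C i ℕ.* (m C i) ℕ.* V i)

    -- Multiplying by (-1)^(2i) = 1 turns the exponent `m ∸ i` into m + i. As m = 1 + 2h, one sign
    -- survives; this is where p ≡ 3 modulo 4 enters.
    -1^[m∸i]≡-[-1^i] : ∀ {i} → i ≤ m → -1ℤ ^ (m ∸ i) ≡ - (-1ℤ ^ i)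
    -1^[m∸i]≡-[-1^i] {i} i≤m = begin
      -1ℤ ^ (m ∸ i)                           ≡⟨ *-identityʳ _ ⟨
      -1ℤ ^ (m ∸ i) * 1ℤ                      ≡⟨ cong (-1ℤ ^ (m ∸ i) *_) (-1^[n+n]≡1 i) ⟨
      -1ℤ ^ (m ∸ i) * -1ℤ ^ (i ℕ.+ i)         ≡⟨ ^-distribˡ-+-* -1ℤ (m ∸ i) (i ℕ.+ i) ⟨
      -1ℤ ^ (m ∸ i ℕ.+ (i ℕ.+ i))             ≡⟨ cong (-1ℤ ^_) (ℕ.+-assoc (m ∸ i) i i) ⟨
      -1ℤ ^ (m ∸ i ℕ.+ i ℕ.+ i)               ≡⟨ cong (λ a → -1ℤ ^ (a ℕ.+ i)) (ℕ.m∸n+n≡m i≤m) ⟩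
      -1ℤ * -1ℤ ^ (h ℕ.+ h ℕ.+ i)             ≡⟨ -1*i≡-i _ ⟩
      - (-1ℤ ^ (h ℕ.+ h ℕ.+ i))               ≡⟨ cong -_ (^-distribˡ-+-* -1ℤ (h ℕ.+ h) i) ⟩
      - (-1ℤ ^ (h ℕ.+ h) * -1ℤ ^ i)           ≡⟨ cong (λ a → - (a * -1ℤ ^ i)) (-1^[n+n]≡1 h) ⟩
      - (1ℤ * -1ℤ ^ i)                        ≡⟨ cong -_ (*-identityˡ _) ⟩
      - (-1ℤ ^ i)                             ∎

    T-antisymmetric : ∀ i → i ≤ m → T (m ∸ i) ≡ - T i
    T-antisymmetric i i≤m = begin
      -1ℤ ^ (m ∸ i) * + (m C (m ∸ i) ℕ.* (m C (m ∸ i)) ℕ.* V (m ∸ i))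
        ≡⟨ cong₂ (λ a b → a * + b) (-1^[m∸i]≡-[-1^i] i≤m)
             (cong₂ (λ a b → a ℕ.* a ℕ.* b) (sym (nCk≡nC[n∸k] i≤m)) (V-symmetric i≤m)) ⟩
      - (-1ℤ ^ i) * + (m C i ℕ.* (m C i) ℕ.* V i)
        ≡⟨ neg-distribˡ-* (-1ℤ ^ i) _ ⟨
      - T i ∎

    p∣∑mCi*c*U : + p ∣ ∑[ i ≤ m ] (+ (m C i ℕ.* c i ℕ.* U i))
    p∣∑mCi*c*U = ∣∑-resp-≡mod (suc m) {g = T} difference
      (subst (+ p ∣_) (sym (∑-antisymmetric m T T-antisymmetric)) (divides 0ℤ refl))
      where
      difference : ∀ i → i < suc m → + p ∣ + (m C i ℕ.* c i ℕ.* U i) - T i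
      difference i i<1+m = subst (+ p ∣_) (sym eq)
        (∣m⇒∣m*n (+ (m C i) * + U i) ([2n]Cn≡-4^n*mCn m p-prime i (ℕ.≤-trans i<1+m (s≤s (ℕ.m≤m+n m m)))))
        where
        regroup : ∀ s a b c u → b * c * u - s * (b * b * (a * u)) ≡ (c - s * a * b) * (b * u)
        regroup = solve-∀
        eq : + (m C i ℕ.* c i ℕ.* U i) - T i ≡ (+ c i - -4ℤ ^ i * + (m C i)) * (+ (m C i) * + U i)
        eq = begin
          + (m C i ℕ.* c i ℕ.* U i) - -1ℤ ^ i * + (m C i ℕ.* (m C i) ℕ.* V i)
            ≡⟨ cong (λ v → + (m C i ℕ.* c i ℕ.* U i) - -1ℤ ^ i * + (m C i ℕ.* (m C i) ℕ.* v)) (4^i*U≡V (s≤s⁻¹ i<1+m)) ⟨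
          + (m C i ℕ.* c i ℕ.* U i) - -1ℤ ^ i * + (m C i ℕ.* (m C i) ℕ.* (4 ℕ.^ i ℕ.* U i))
            ≡⟨ cong₂ (λ x y → x - -1ℤ ^ i * y)
                 (pos-*₃ (m C i) (c i) (U i))
                 (trans (pos-*₃ (m C i) (m C i) _) (cong ((+ (m C i) * + (m C i)) *_) (pos-* (4 ℕ.^ i) (U i)))) ⟩
          + (m C i) * + c i * + U i - -1ℤ ^ i * (+ (m C i) * + (m C i) * (+ (4 ℕ.^ i) * + U i))
            ≡⟨ regroup (-1ℤ ^ i) (+ (4 ℕ.^ i)) (+ (m C i)) (+ c i) (+ U i) ⟩
          (+ c i - -1ℤ ^ i * + (4 ℕ.^ i) * + (m C i)) * (+ (m C i) * + U i)
            ≡⟨ cong (λ a → (+ c i - a * + (m C i)) * (+ (m C i) * + U i)) (-4^n≡-1^n*4^n i) ⟨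
          (+ c i - -4ℤ ^ i * + (m C i)) * (+ (m C i) * + U i) ∎
          where
          pos-*₃ : ∀ x y z → + (x ℕ.* y ℕ.* z) ≡ + x * + y * + z
          pos-*₃ x y z = trans (pos-* (x ℕ.* y) z) (cong (_* + z) (pos-* x y))

    p∣∑w*mCk*franel : + p ∣ ∑[ k < p ] (+ (w k ℕ.* (m C k ℕ.* franel k)))
    p∣∑w*mCk*franel = subst (+ p ∣_) (sym (begin
      ∑[ k < p ] (+ a k)                          ≡⟨ ∑-pos p a ⟨
      -- `p` unfolds to `suc m + m`, and the last `m` terms contain `m C k` with `k > m`.
      + ℕ∑.sum< (suc m ℕ.+ m) a                   ≡⟨ cong +_ (ℕ∑.∑-truncate (suc m) m a a≡0) ⟩
      + ℕ∑.sum≤ m a                               ≡⟨ cong +_ (∑w*mCn*franel m w) ⟩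
      + ℕ∑.sum≤ m (λ i → m C i ℕ.* c i ℕ.* U i)   ≡⟨ ∑-pos (suc m) _ ⟩
      ∑[ i ≤ m ] (+ (m C i ℕ.* c i ℕ.* U i))      ∎)) p∣∑mCi*c*U
      where
      a : ℕ → ℕ
      a k = w k ℕ.* (m C k ℕ.* franel k)
      a≡0 : ∀ k → m < k → a k ≡ 0
      a≡0 k m<k = trans (cong (λ b → w k ℕ.* (b ℕ.* franel k)) (k>n⇒nCk≡0 m<k)) (ℕ.*-zeroʳ (w k))

    -- Write -16 as -4 times 4. The powers of -4 combine to (-4)^e, which is 4^e because `e = m + m`
    -- is even.
    -4^k*-16^[e∸k]≡w : ∀ {k} → k ≤ e → -4ℤ ^ k * -16ℤ ^ (e ∸ k) ≡ + w k
    -4^k*-16^[e∸k]≡w {k} k≤e = begin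
      -4ℤ ^ k * -16ℤ ^ (e ∸ k)
        ≡⟨ cong (-4ℤ ^ k *_) (^-distribʳ-* (e ∸ k) -4ℤ (+ 4)) ⟩
      -4ℤ ^ k * (-4ℤ ^ (e ∸ k) * (+ 4) ^ (e ∸ k))
        ≡⟨ *-assoc (-4ℤ ^ k) _ _ ⟨
      -4ℤ ^ k * -4ℤ ^ (e ∸ k) * (+ 4) ^ (e ∸ k)
        ≡⟨ cong (_* (+ 4) ^ (e ∸ k)) (^-distribˡ-+-* -4ℤ k (e ∸ k)) ⟨
      -4ℤ ^ (k ℕ.+ (e ∸ k)) * (+ 4) ^ (e ∸ k)
        ≡⟨ cong (λ a → -4ℤ ^ a * (+ 4) ^ (e ∸ k)) (ℕ.m+[n∸m]≡n k≤e) ⟩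
      -4ℤ ^ e * (+ 4) ^ (e ∸ k)
        ≡⟨ cong (_* (+ 4) ^ (e ∸ k)) (^-distribʳ-* e -1ℤ (+ 4)) ⟩
      -1ℤ ^ e * (+ 4) ^ e * (+ 4) ^ (e ∸ k)
        ≡⟨ cong (λ a → a * (+ 4) ^ e * (+ 4) ^ (e ∸ k)) (-1^[n+n]≡1 m) ⟩
      1ℤ * (+ 4) ^ e * (+ 4) ^ (e ∸ k)
        ≡⟨ cong (_* (+ 4) ^ (e ∸ k)) (*-identityˡ ((+ 4) ^ e)) ⟩
      (+ 4) ^ e * (+ 4) ^ (e ∸ k)
        ≡⟨ ^-distribˡ-+-* (+ 4) e (e ∸ k) ⟨
      (+ 4) ^ (e ℕ.+ (e ∸ k))
        ≡⟨ cong ((+ 4) ^_) (ℕ.+-∸-assoc e k≤e) ⟨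
      (+ 4) ^ (e ℕ.+ e ∸ k)
        ≡⟨ pos-^ 4 (e ℕ.+ e ∸ k) ⟨
      + w k ∎

    p∣scaledFranelSum : + p ∣ scaledFranelSum e
    p∣scaledFranelSum = ∣∑-resp-≡mod p difference p∣∑w*mCk*franel
      where
      difference : ∀ k → k < p →
        + p ∣ + (c k ℕ.* franel k) * -16ℤ ^ (e ∸ k) - + (w k ℕ.* (m C k ℕ.* franel k))
      difference k k<p = subst (+ p ∣_) (sym eq)
        (∣m⇒∣m*n (+ franel k * -16ℤ ^ (e ∸ k)) ([2n]Cn≡-4^n*mCn m p-prime k k<p))
        where
        regroup : ∀ c f r q b → c * f * r - q * r * (b * f) ≡ (c - q * b) * (f * r)
        regroup = solve-∀
        eq : + (c k ℕ.* franel k) * -16ℤ ^ (e ∸ k) - + (w k ℕ.* (m C k ℕ.* franel k)) ≡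
             (+ c k - -4ℤ ^ k * + (m C k)) * (+ franel k * -16ℤ ^ (e ∸ k))
        eq = begin
          + (c k ℕ.* franel k) * -16ℤ ^ (e ∸ k) - + (w k ℕ.* (m C k ℕ.* franel k))
            ≡⟨ cong₂ (λ x y → x * -16ℤ ^ (e ∸ k) - y) (pos-* (c k) (franel k))
                 (trans (pos-* (w k) _) (cong₂ _*_ (sym (-4^k*-16^[e∸k]≡w (s≤s⁻¹ k<p))) (pos-* (m C k) (franel k)))) ⟩
          + c k * + franel k * -16ℤ ^ (e ∸ k) - -4ℤ ^ k * -16ℤ ^ (e ∸ k) * (+ (m C k) * + franel k)
            ≡⟨ regroup (+ c k) (+ franel k) (-16ℤ ^ (e ∸ k)) (-4ℤ ^ k) (+ (m C k)) ⟩
          (+ c k - -4ℤ ^ k * + (m C k)) * (+ franel k * -16ℤ ^ (e ∸ k)) ∎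

-- Back from integers to reduced fractions.

module _ where

  open import Data.Integer.Base using (+_; ∣_∣)
  open import Data.Integer.Divisibility using (_∣_)
  open ≡
  open import Data.Rational.Base using (_+_; _*_; _/_)

  toℚᵘ[i/1]≃ : ∀ i → ℚ.toℚᵘ (i / 1) ℚᵘ.≃ ℚᵘ.mkℚᵘ i 0
  toℚᵘ[i/1]≃ i = ℚ.toℚᵘ-fromℚᵘ (ℚᵘ.mkℚᵘ i 0)

  -- `_/ 1` normalises through a gcd that does not compute on variables, so the equation is checked
  -- among unnormalised rationals.
  /1-homo-+ : ∀ i j → (i ℤ.+ j) / 1 ≡ i / 1 + j / 1
  /1-homo-+ i j = ℚ.toℚᵘ-injective (begin-equality
    ℚ.toℚᵘ ((i ℤ.+ j) / 1)                  ≃⟨ toℚᵘ[i/1]≃ (i ℤ.+ j) ⟩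
    ℚᵘ.mkℚᵘ (i ℤ.+ j) 0                     ≡⟨ cong₂ (λ a b → ℚᵘ.mkℚᵘ (a ℤ.+ b) 0) (ℤ.*-identityʳ i) (ℤ.*-identityʳ j) ⟨
    ℚᵘ.mkℚᵘ i 0 ℚᵘ.+ ℚᵘ.mkℚᵘ j 0            ≃⟨ ℚᵘ.+-cong (toℚᵘ[i/1]≃ i) (toℚᵘ[i/1]≃ j) ⟨
    ℚ.toℚᵘ (i / 1) ℚᵘ.+ ℚ.toℚᵘ (j / 1)      ≃⟨ ℚ.toℚᵘ-homo-+ (i / 1) (j / 1) ⟨
    ℚ.toℚᵘ (i / 1 + j / 1)                  ∎)
    where open ℚᵘ.≤-Reasoning

  /1-homo-* : ∀ i j → (i ℤ.* j) / 1 ≡ (i / 1) * (j / 1)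
  /1-homo-* i j = ℚ.toℚᵘ-injective (begin-equality
    ℚ.toℚᵘ ((i ℤ.* j) / 1)                  ≃⟨ toℚᵘ[i/1]≃ (i ℤ.* j) ⟩
    ℚᵘ.mkℚᵘ i 0 ℚᵘ.* ℚᵘ.mkℚᵘ j 0            ≃⟨ ℚᵘ.*-cong (toℚᵘ[i/1]≃ i) (toℚᵘ[i/1]≃ j) ⟨
    ℚ.toℚᵘ (i / 1) ℚᵘ.* ℚ.toℚᵘ (j / 1)      ≃⟨ ℚ.toℚᵘ-homo-* (i / 1) (j / 1) ⟨
    ℚ.toℚᵘ ((i / 1) * (j / 1))              ∎)
    where open ℚᵘ.≤-Reasoning

  x*d/1≡n/1⇒↥x*d≡n*↧x : ∀ x d n → x * (d / 1) ≡ n / 1 → ↥ x ℤ.* d ≡ n ℤ.* ↧ x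
  -- Matching on the record lets `toℚᵘ x` reduce to a numerator and a denominator.
  x*d/1≡n/1⇒↥x*d≡n*↧x x@record{} d n eq = begin
    ↥ x ℤ.* d                ≡⟨ ℤ.*-identityʳ _ ⟨
    ↥ x ℤ.* d ℤ.* + 1        ≡⟨ ℚᵘ.drop-*≡* x*d≃n ⟩
    n ℤ.* (↧ x ℤ.* + 1)      ≡⟨ cong (n ℤ.*_) (ℤ.*-identityʳ (↧ x)) ⟩
    n ℤ.* ↧ x                ∎
    where
    open ≡-Reasoning
    x*d≃n : ℚ.toℚᵘ x ℚᵘ.* ℚᵘ.mkℚᵘ d 0 ℚᵘ.≃ ℚᵘ.mkℚᵘ n 0
    x*d≃n = ℚᵘ.≃-trans (ℚᵘ.*-cong (ℚᵘ.≃-refl {ℚ.toℚᵘ x}) (ℚᵘ.≃-sym (toℚᵘ[i/1]≃ d)))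
      (ℚᵘ.≃-trans (ℚᵘ.≃-sym (ℚ.toℚᵘ-homo-* x (d / 1)))
        (ℚᵘ.≃-trans (ℚ.toℚᵘ-cong eq) (toℚᵘ[i/1]≃ n)))

  summand*-16^k : ∀ k → summand k * ((-16ℤ ℤ.^ k) / 1) ≡ + ((2 ℕ.* k) C k ℕ.* franel k) / 1
  summand*-16^k k = begin
    a * ℚ.1/ d * d     ≡⟨ ℚ.*-assoc a (ℚ.1/ d) d ⟩
    a * (ℚ.1/ d * d)   ≡⟨ cong (a *_) (ℚ.*-inverseˡ d) ⟩
    a * 1ℚ             ≡⟨ ℚ.*-identityʳ a ⟩
    a                  ∎
    where
    open ≡-Reasoning
    a = + ((2 ℕ.* k) C k ℕ.* franel k) / 1
    d = (-16ℤ ℤ.^ k) / 1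
    instance _ = ℚ.≢-nonZero ([-16]^k/1≢0 k)

  franelSum*-16^e : ∀ e → franelSum (suc e) * ((-16ℤ ℤ.^ e) / 1) ≡ scaledFranelSum e / 1
  franelSum*-16^e e = begin
    franelSum (suc e) * D
      ≡⟨ cong (_* D) (ℚ∑.sum<-sum (suc e) summand) ⟨
    ℚ∑.sum≤ e summand * D
      ≡⟨ ℚ.*-comm (ℚ∑.sum≤ e summand) D ⟩
    D * ℚ∑.sum≤ e summand
      ≡⟨ ℚ∑.*-distribˡ-∑ (suc e) D summand ⟩
    ℚ∑.sum≤ e (λ k → D * summand k)
      ≡⟨ ℚ∑.∑-cong (suc e) (λ k k<1+e → clear k (s≤s⁻¹ k<1+e)) ⟩
    ℚ∑.sum≤ e (λ k → (+ a k ℤ.* -16ℤ ℤ.^ (e ∸ k)) / 1)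
      ≡⟨ ∑-homo ℤ.+-*-semiring ℚ-semiring (_/ 1) refl /1-homo-+ (suc e) _ ⟨
    scaledFranelSum e / 1 ∎
    where
    open ≡-Reasoning
    D = (-16ℤ ℤ.^ e) / 1
    a : ℕ → ℕ
    a k = (2 ℕ.* k) C k ℕ.* franel k
    clear : ∀ k → k ≤ e → D * summand k ≡ (+ a k ℤ.* -16ℤ ℤ.^ (e ∸ k)) / 1
    clear k k≤e = begin
      D * summand k
        ≡⟨ ℚ.*-comm D (summand k) ⟩
      summand k * D
        ≡⟨ cong (λ j → summand k * ((-16ℤ ℤ.^ j) / 1)) (ℕ.m+[n∸m]≡n k≤e) ⟨
      summand k * ((-16ℤ ℤ.^ (k ℕ.+ (e ∸ k))) / 1)
        ≡⟨ cong (λ j → summand k * (j / 1)) (ℤ.^-distribˡ-+-* -16ℤ k (e ∸ k)) ⟩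
      summand k * ((-16ℤ ℤ.^ k ℤ.* r) / 1)
        ≡⟨ cong (summand k *_) (/1-homo-* (-16ℤ ℤ.^ k) r) ⟩
      summand k * ((-16ℤ ℤ.^ k) / 1 * (r / 1))
        ≡⟨ ℚ.*-assoc (summand k) _ _ ⟨
      summand k * ((-16ℤ ℤ.^ k) / 1) * (r / 1)
        ≡⟨ cong (_* (r / 1)) (summand*-16^k k) ⟩
      + a k / 1 * (r / 1)
        ≡⟨ /1-homo-* (+ a k) r ⟨
      (+ a k ℤ.* r) / 1 ∎
      where r = -16ℤ ℤ.^ (e ∸ k)

  prime∣^⇒∣ : ∀ {p} → Prime p → ∀ b n → p ℕ.∣ b ℕ.^ n → p ℕ.∣ b
  prime∣^⇒∣ p-prime b zero    p∣1 = contradiction (subst Prime (ℕ.∣1⇒≡1 p∣1) p-prime) ¬prime[1]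
  prime∣^⇒∣ p-prime b (suc n) p∣b^1+n =
    [ id , prime∣^⇒∣ p-prime b n ]′ (euclidsLemma b (b ℕ.^ n) p-prime p∣b^1+n)

  abs-^ : ∀ i n → ∣ i ℤ.^ n ∣ ≡ ∣ i ∣ ℕ.^ n
  abs-^ i zero    = refl
  abs-^ i (suc n) = trans (ℤ.abs-* i (i ℤ.^ n)) (cong (∣ i ∣ ℕ.*_) (abs-^ i n))

  ∤⇒coprime : ∀ {p n} → Prime p → ¬ p ℕ.∣ n → Coprimality.Coprime n p
  ∤⇒coprime p-prime p∤n (d∣n , d∣p) with prime⇒irreducible p-prime d∣p
  ... | inj₁ d≡1 = d≡1
  ... | inj₂ d≡p = contradiction (subst (ℕ._∣ _) d≡p d∣n) p∤n

  ↥-↧-coprime : ∀ x → Coprimality.Coprime ∣ ↥ x ∣ (↧ₙ x)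
  ↥-↧-coprime (mkℚ n d-1 coprime) = Coprimality.recompute coprime

  -- Everything follows from `↥ x * d = n * ↧ x`. Euclid's lemma puts `p` into `↥ x`, and since
  -- `↧ x` is coprime to `↥ x` it divides `d`, so `p` does not divide `↧ x`.
  ≡0[mod] : ∀ {p} → Prime p → ∀ x d n → ¬ p ℕ.∣ ∣ d ∣ → + p ∣ n → x * (d / 1) ≡ n / 1 → x ≡ 0ℚ [mod p ]
  ≡0[mod] {p} p-prime x d n p∤d p∣n eq =
    subst (λ y → + p ∣ ↥ y) x≡x-0 p∣↥x , subst (λ y → Coprimality.Coprime (↧ₙ y) p) x≡x-0 (∤⇒coprime p-prime p∤↧x)
    where
    x≡x-0 : x ≡ x ℚ.- 0ℚ
    x≡x-0 = sym (ℚ.+-identityʳ x)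
    abs-eq : ∣ ↥ x ∣ ℕ.* ∣ d ∣ ≡ ∣ n ∣ ℕ.* ↧ₙ x
    abs-eq = trans (sym (ℤ.abs-* (↥ x) d)) (trans (cong ∣_∣ (x*d/1≡n/1⇒↥x*d≡n*↧x x d n eq)) (ℤ.abs-* n (↧ x)))
    p∣↥x : p ℕ.∣ ∣ ↥ x ∣
    p∣↥x = [ id , (λ p∣d → contradiction p∣d p∤d) ]′ (euclidsLemma ∣ ↥ x ∣ ∣ d ∣ p-prime
      (subst (p ℕ.∣_) (sym abs-eq) (ℕ.∣m⇒∣m*n (↧ₙ x) p∣n)))
    ↧x∣d : ↧ₙ x ℕ.∣ ∣ d ∣
    ↧x∣d = Coprimality.coprime-divisor (Coprimality.sym (↥-↧-coprime x))
      (subst (↧ₙ x ℕ.∣_) (sym abs-eq) (ℕ.n∣m*n ∣ n ∣))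
    p∤↧x : ¬ p ℕ.∣ ↧ₙ x
    p∤↧x p∣↧x = p∤d (ℕ.∣-trans p∣↧x ↧x∣d)

theorem1p3 : (p : ℕ) → Prime p → p % 4 ≡ 3 → franelSum p ≡ 0ℚ [mod p ]
theorem1p3 p p-prime p%4≡3 = subst (λ q → franelSum q ≡ 0ℚ [mod q ]) (sym p≡)
  (≡0[mod] prime′ (franelSum (suc e)) (-16ℤ ℤ.^ e) (scaledFranelSum e) p∤16^e
    (∣⇒∣ᵤ (Congruence.p∣scaledFranelSum h prime′))
    (franelSum*-16^e e))
  where
  open ≡
  h = p ℕ./ 4
  m = suc (h ℕ.+ h)
  e = m ℕ.+ m
  p≡ : p ≡ suc e
  p≡ = trans (ℕ.m≡m%n+[m/n]*n p 4) (trans (cong (ℕ._+ h ℕ.* 4) p%4≡3) (3+4h≡ h))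
    where
    3+4h≡ : ∀ h → 3 ℕ.+ h ℕ.* 4 ≡ suc (suc (h ℕ.+ h) ℕ.+ suc (h ℕ.+ h))
    3+4h≡ = solveℕ-∀
  prime′ : Prime (suc e)
  prime′ = subst Prime p≡ p-prime
  p∤2 : ¬ suc e ℕ.∣ 2
  -- From `1 ≤ m` comes `2 ≤ e`, so the prime exceeds 2.
  p∤2 p∣2 = contradiction (ℕ.∣⇒≤ p∣2) (ℕ.<⇒≱ (s≤s (ℕ.+-mono-≤ {1} {m} {1} {m} (s≤s z≤n) (s≤s z≤n))))
  p∤16^e : ¬ suc e ℕ.∣ ℤ.∣ -16ℤ ℤ.^ e ∣
  -- The inner descent goes from 16^e to 16, the outer one from 16, read as 2^4, to 2.
  p∤16^e p∣ = p∤2 (prime∣^⇒∣ prime′ 2 4 (prime∣^⇒∣ prime′ 16 e (subst (suc e ℕ.∣_) (abs-^ -16ℤ e) p∣)))
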